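{- For every $\Gamma\cup\{\varphi\}\subseteq For(\Sigma)$: if $\Gamma\models_{\mathbb{NM}}\varphi$ then $\Gamma\vdash_{\mathbf{RmbC}}\varphi$.
   Context: Let $\Sigma=\{\wedge,\vee,\to,\neg,\circ\}$ ($\neg,\circ$ unary, the others binary) and let $For(\Sigma)$ be the set of formulas over $\Sigma$ generated by a denumerable set $\mathcal V$ of propositional variables. $\alpha\leftrightarrow\beta$ abbreviates $(\alpha\to\beta)\wedge(\beta\to\alpha)$. $\mathbf{RmbC}$ is the Hilbert calculus with axiom schemas: (Ax1) $\alpha\to(\beta\to\alpha)$; (Ax2) $(\alpha\to(\beta\to\gamma))\to((\alpha\to\beta)\to(\alpha\to\gamma))$; (Ax3) $\alpha\to(\beta\to(\alpha\wedge\beta))$; (Ax4) $(\alpha\wedge\beta)\to\alpha$; (Ax5) $(\alpha\wedge\beta)\to\beta$; (Ax6) $\alpha\to(\alpha\vee\beta)$; (Ax7) $\beta\to(\alpha\vee\beta)$; (Ax8) $(\alpha\to\gamma)\to((\beta\to\gamma)\to((\alpha\vee\beta)\to\gamma))$; (Ax9) $(\alpha\to\beta)\vee\alpha$; (Ax10) $\alpha\vee\neg\alpha$; (bc1) $\circ\alpha\to(\alpha\to(\neg\alpha\to\beta))$; and rules: (MP) from $\alpha$ and $\alpha\to\beta$ infer $\beta$; $(\mathbf R_\neg)$ from $\alpha\leftrightarrow\beta$ infer $\neg\alpha\leftrightarrow\neg\beta$; $(\mathbf R_\circ)$ from $\alpha\leftrightarrow\beta$ infer $\circ\alpha\leftrightarrow\circ\beta$.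 A formula $\varphi$ is a theorem ($\vdash_{\mathbf{RmbC}}\varphi$) if there is a finite sequence of formulas ending in $\varphi$ each of which is an instance of an axiom schema or follows from earlier formulas of the sequence by a rule. $\Gamma\vdash_{\mathbf{RmbC}}\varphi$ means that either $\vdash_{\mathbf{RmbC}}\varphi$ or there is a finite non-empty $\{\gamma_1,\dots,\gamma_n\}\subseteq\Gamma$ with $\vdash_{\mathbf{RmbC}}(\gamma_1\wedge(\gamma_2\wedge(\cdots\wedge(\gamma_{n-1}\wedge\gamma_n)\cdots)))\to\varphi$. A neighborhood frame for $\mathbf{RmbC}$ is a triple $\mathcal F=\langle W,S_\neg,S_\circ\rangle$ with $W$ a non-empty set and $S_\neg,S_\circ:\wp(W)\to\wp(W)$ arbitrary functions. A neighborhood model is $\mathcal M=\langle\mathcal F,d\rangle$ with $d:\mathcal V\to\wp(W)$. The denotation $[\![\cdot]\!]_{\mathcal M}:For(\Sigma)\to\wp(W)$ is defined by: $[\![p]\!]=d(p)$; $[\![\varphi\wedge\psi]\!]=[\![\varphi]\!]\cap[\![\psi]\!]$; $[\![\varphi\vee\psi]\!]=[\![\varphi]\!]\cup[\![\psi]\!]$; $[\![\varphi\to\psi]\!]=(W\setminus[\![\varphi]\!])\cup[\![\psi]\!]$; $[\![\neg\varphi]\!]=(W\setminus[\![\varphi]\!])\cup S_\neg([\![\varphi]\!])$; $[\![\circ\varphi]\!]=(W\setminus([\![\varphi]\!]\cap S_\neg([\![\varphi]\!])))\cap S_\circ([\![\varphi]\!])$. $\models_{\mathbb{NM}}\varphi$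 means $[\![\varphi]\!]_{\mathcal M}=W$ for every neighborhood model $\mathcal M$. $\Gamma\models_{\mathbb{NM}}\varphi$ means that either $\models_{\mathbb{NM}}\varphi$ or there is a finite non-empty $\{\gamma_1,\dots,\gamma_n\}\subseteq\Gamma$ with $\models_{\mathbb{NM}}(\gamma_1\wedge\cdots\wedge\gamma_n)\to\varphi$. -}

module Defs where

open import Data.Bool.Base as Bool using (Bool; true)
open import Data.List.Base using (List; []; _∷_)
open import Data.List.Membership.Propositional using (_∈_)
open import Data.List.NonEmpty.Base using (List⁺; foldr₁)
open import Data.List.NonEmpty.Relation.Unary.All using (All)
open import Data.Nat.Base using (ℕ)
open import Data.Product.Base using (∃-syntax; _×_)
open import Data.Sum.Base using (_⊎_)
open import Level using (Level; _⊔_; 0ℓ; suc)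
open import Relation.Binary.PropositionalEquality using (_≗_)
open import Relation.Unary using (Pred)

private
  variable
    ℓ : Level

infix  9 ¬_ ∘_
infixr 7 _∧_
infixr 6 _∨_
infixr 5 _⇒_
infix  4 _⇔_

data Formula : Set where
  var : ℕ → Formula
  _∧_ _∨_ _⇒_ : Formula → Formula → Formula
  ¬_ ∘_ : Formula → Formula

_⇔_ : Formula → Formula → Formula
α ⇔ β = (α ⇒ β) ∧ (β ⇒ α)

-- γ₁ ∧ (γ₂ ∧ (⋯ ∧ (γₙ₋₁ ∧ γₙ)⋯)), which is just γ₁ when n = 1.
⋀ : List⁺ Formula → Formula
⋀ = foldr₁ _∧_

data Axiom : Pred Formula 0ℓ where
  ax1  : ∀ α β → Axiom (α ⇒ (β ⇒ α))
  ax2  : ∀ α β γ → Axiom ((α ⇒ (β ⇒ γ)) ⇒ ((α ⇒ β) ⇒ (α ⇒ γ)))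
  ax3  : ∀ α β → Axiom (α ⇒ (β ⇒ (α ∧ β)))
  ax4  : ∀ α β → Axiom ((α ∧ β) ⇒ α)
  ax5  : ∀ α β → Axiom ((α ∧ β) ⇒ β)
  ax6  : ∀ α β → Axiom (α ⇒ (α ∨ β))
  ax7  : ∀ α β → Axiom (β ⇒ (α ∨ β))
  ax8  : ∀ α β γ → Axiom ((α ⇒ γ) ⇒ ((β ⇒ γ) ⇒ ((α ∨ β) ⇒ γ)))
  ax9  : ∀ α β → Axiom ((α ⇒ β) ∨ α)
  ax10 : ∀ α → Axiom (α ∨ (¬ α))
  bc1  : ∀ α β → Axiom ((∘ α) ⇒ (α ⇒ ((¬ α) ⇒ β)))

-- Justified φs φ: φ may be appended to a derivation whose formulas so far
-- are φs.
data Justified (φs : List Formula) : Pred Formula 0ℓ where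
  axiom : ∀ {α} → Axiom α → Justified φs α
  MP    : ∀ {α β} → α ∈ φs → (α ⇒ β) ∈ φs → Justified φs β
  R¬    : ∀ {α β} → (α ⇔ β) ∈ φs → Justified φs ((¬ α) ⇔ (¬ β))
  R∘    : ∀ {α β} → (α ⇔ β) ∈ φs → Justified φs ((∘ α) ⇔ (∘ β))

-- Derivations are listed in reverse: the head is the last formula.
data Derivation : Pred (List Formula) 0ℓ where
  []  : Derivation []
  _∷_ : ∀ {φ φs} → Justified φs φ → Derivation φs → Derivation (φ ∷ φs)

infix 3 ⊢_ _⊢_ ⊨_ _⊨_

⊢_ : Pred Formula 0ℓ
⊢ φ = ∃[ φs ] Derivation (φ ∷ φs)

-- The list γs enumerates a finite non-empty subset of Γ.
_⊢_ : Pred Formula ℓ → Pred Formula ℓ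
Γ ⊢ φ = (⊢ φ) ⊎ (∃[ γs ] All Γ γs × (⊢ ⋀ γs ⇒ φ))

-- The power set is the classical, two-valued one: a subset is given by its
-- characteristic function, so that X ∪ (W \ X) = W holds.  Subsets are equal
-- when their characteristic functions agree pointwise (_≗_).
℘ : Set → Set
℘ W = W → Bool

module _ {W : Set} where

  infixr 7 _∩_
  infixr 6 _∪_

  full : ℘ W
  full _ = true

  ∁ : ℘ W → ℘ W
  ∁ X w = Bool.not (X w)

  _∩_ _∪_ : ℘ W → ℘ W → ℘ W
  (X ∩ Y) w = X w Bool.∧ Y w
  (X ∪ Y) w = X w Bool.∨ Y w

-- S¬-cong and S∘-cong say only that S¬ and S∘ are functions on subsets, that
-- is, that they respect equality of subsets; without function extensionality
-- this is not automatic.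
record Frame : Set₁ where
  field
    W       : Set
    point   : W
    S¬ S∘   : ℘ W → ℘ W
    S¬-cong : ∀ {X Y} → X ≗ Y → S¬ X ≗ S¬ Y
    S∘-cong : ∀ {X Y} → X ≗ Y → S∘ X ≗ S∘ Y

record Model : Set₁ where
  field
    frame : Frame
  open Frame frame public
  field
    d : ℕ → ℘ W

  ⟦_⟧ : Formula → ℘ W
  ⟦ var p ⟧ = d p
  ⟦ φ ∧ ψ ⟧ = ⟦ φ ⟧ ∩ ⟦ ψ ⟧
  ⟦ φ ∨ ψ ⟧ = ⟦ φ ⟧ ∪ ⟦ ψ ⟧
  ⟦ φ ⇒ ψ ⟧ = ∁ ⟦ φ ⟧ ∪ ⟦ ψ ⟧
  ⟦ ¬ φ ⟧   = ∁ ⟦ φ ⟧ ∪ S¬ ⟦ φ ⟧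
  ⟦ ∘ φ ⟧   = ∁ (⟦ φ ⟧ ∩ S¬ ⟦ φ ⟧) ∩ S∘ ⟦ φ ⟧

⊨_ : Pred Formula (suc 0ℓ)
⊨ φ = ∀ (M : Model) → Model.⟦_⟧ M φ ≗ full

_⊨_ : Pred Formula ℓ → Pred Formula (suc 0ℓ ⊔ ℓ)
Γ ⊨ φ = (⊨ φ) ⊎ (∃[ γs ] All Γ γs × (⊨ ⋀ γs ⇒ φ))

{-# OPTIONS --safe #-}
module Submission where

-- Let A be the variables and the formulas ¬ α, ∘ α occurring in φ.  Start from
-- the finite list of all Boolean valuations of A, and delete those that
-- violate an instance of R¬ or R∘ whose premise holds under every valuation
-- still present.  Every valuation deleted is refutable in RmbC, so a formula
-- over A that is true under all surviving valuations is a theorem.  The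
-- survivors are the worlds of a neighborhood model: closure under the rules
-- says that the truth sets of ¬ α and ∘ α depend only on the truth set of α.

open import Defs
open import Level using (Level)
open import Relation.Unary using (Pred; Decidable)

open import Data.Bool.Base as Bool using (Bool; true; false; not; if_then_else_)
open import Data.Bool.Properties as Bool using (∨-assoc; ∨-idem; ¬-not; ∧-assoc; ∧-idem)
open import Data.Fin.Base using (Fin)
open import Data.Fin.Properties using (all?)
open import Data.List.Base
  using (List; []; _∷_; _++_; [_]; length; lookup; filter; cartesianProductWith)
open import Data.List.Membership.Propositional using (_∈_; find; lose)
open import Data.List.Membership.Propositional.Properties
  using (∈-++⁺ˡ; ∈-++⁺ʳ; ∈-++⁻; ∈-cartesianProductWith⁺; ∈-filter⁺; ∈-lookup)
open import Data.List.Properties using (filter-notAll)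
open import Data.List.Relation.Binary.Subset.Propositional using (_⊆_)
open import Data.List.Relation.Binary.Subset.Propositional.Properties
  using (xs⊆xs++ys)
open import Data.List.Relation.Unary.All as All using (All)
open import Data.List.Relation.Unary.All.Properties
  using (¬All⇒Any¬; ++⁺; cartesianProductWith⁺)
open import Data.List.Relation.Unary.Any as Any using (Any; here; there)
open import Data.List.Relation.Unary.Any.Properties using (lookup-index)
open import Data.Nat.Base using (_<_)
open import Data.Nat.Induction using (Acc; acc; <-wellFounded)
import Data.Nat.Properties as ℕ
open import Data.Product.Base as Product using (∃-syntax; _×_; _,_; proj₁; proj₂; uncurry)
open import Data.Sum.Base as Sum using ([_,_]′)
open import Function.Base using (id; _∘′_; case_of_)
open import Function.Bundles using (mk⇔)
open import Relation.Binary.Definitions using (DecidableEquality)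
open import Relation.Binary.PropositionalEquality
  using (_≡_; _≗_; refl; sym; trans; cong; cong₂; subst; setoid)
import Relation.Nullary as Nullary
open import Relation.Nullary using (Dec; yes; no; does; contradiction)
open import Relation.Nullary.Decidable
  using (map′; _×-dec_; _→-dec_; does-⇔; dec-true; dec-false)

-- Decidable equality of formulas

infix 4 _≟_

_≟_ : DecidableEquality Formula
var p   ≟ var q   = map′ (cong var) (λ { refl → refl }) (p ℕ.≟ q)
(α ∧ β) ≟ (γ ∧ δ) =
  map′ (uncurry (cong₂ _∧_)) (λ { refl → refl , refl }) (α ≟ γ ×-dec β ≟ δ)
(α ∨ β) ≟ (γ ∨ δ) =
  map′ (uncurry (cong₂ _∨_)) (λ { refl → refl , refl }) (α ≟ γ ×-dec β ≟ δ)
(α ⇒ β) ≟ (γ ⇒ δ) =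
  map′ (uncurry (cong₂ _⇒_)) (λ { refl → refl , refl }) (α ≟ γ ×-dec β ≟ δ)
(¬ α)   ≟ (¬ β)   = map′ (cong ¬_) (λ { refl → refl }) (α ≟ β)
(∘ α)   ≟ (∘ β)   = map′ (cong ∘_) (λ { refl → refl }) (α ≟ β)
var _   ≟ (_ ∧ _) = no λ ()
var _   ≟ (_ ∨ _) = no λ ()
var _   ≟ (_ ⇒ _) = no λ ()
var _   ≟ (¬ _)   = no λ ()
var _   ≟ (∘ _)   = no λ ()
(_ ∧ _) ≟ var _   = no λ ()
(_ ∧ _) ≟ (_ ∨ _) = no λ ()
(_ ∧ _) ≟ (_ ⇒ _) = no λ ()
(_ ∧ _) ≟ (¬ _)   = no λ ()
(_ ∧ _) ≟ (∘ _)   = no λ ()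
(_ ∨ _) ≟ var _   = no λ ()
(_ ∨ _) ≟ (_ ∧ _) = no λ ()
(_ ∨ _) ≟ (_ ⇒ _) = no λ ()
(_ ∨ _) ≟ (¬ _)   = no λ ()
(_ ∨ _) ≟ (∘ _)   = no λ ()
(_ ⇒ _) ≟ var _   = no λ ()
(_ ⇒ _) ≟ (_ ∧ _) = no λ ()
(_ ⇒ _) ≟ (_ ∨ _) = no λ ()
(_ ⇒ _) ≟ (¬ _)   = no λ ()
(_ ⇒ _) ≟ (∘ _)   = no λ ()
(¬ _)   ≟ var _   = no λ ()
(¬ _)   ≟ (_ ∧ _) = no λ ()
(¬ _)   ≟ (_ ∨ _) = no λ ()
(¬ _)   ≟ (_ ⇒ _) = no λ ()
(¬ _)   ≟ (∘ _)   = no λ ()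
(∘ _)   ≟ var _   = no λ ()
(∘ _)   ≟ (_ ∧ _) = no λ ()
(∘ _)   ≟ (_ ∨ _) = no λ ()
(∘ _)   ≟ (_ ⇒ _) = no λ ()
(∘ _)   ≟ (¬ _)   = no λ ()

private
  variable
    Γ Δ : List Formula
    α β γ ψ : Formula

-- Derivability

justified-⊆ : Γ ⊆ Δ → Justified Γ ψ → Justified Δ ψ
justified-⊆ Γ⊆Δ (axiom a)  = axiom a
justified-⊆ Γ⊆Δ (MP p q)   = MP (Γ⊆Δ p) (Γ⊆Δ q)
justified-⊆ Γ⊆Δ (R¬ p)     = R¬ (Γ⊆Δ p)
justified-⊆ Γ⊆Δ (R∘ p)     = R∘ (Γ⊆Δ p)

derivation-++ : Derivation Γ → Derivation Δ → Derivation (Γ ++ Δ)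
derivation-++ []      e = e
derivation-++ (j ∷ d) e = justified-⊆ (xs⊆xs++ys _ _) j ∷ derivation-++ d e

⊢-axiom : Axiom α → ⊢ α
⊢-axiom a = [] , axiom a ∷ []

⊢-mp : ⊢ α ⇒ β → ⊢ α → ⊢ β
⊢-mp {α} {β} (φs , d) (_ , e) =
  _ , MP (∈-++⁺ʳ ((α ⇒ β) ∷ φs) (here refl)) (here refl) ∷ derivation-++ d e

⊢-R¬ : ⊢ α ⇔ β → ⊢ ¬ α ⇔ ¬ β
⊢-R¬ (_ , d) = _ , R¬ (here refl) ∷ d

⊢-R∘ : ⊢ α ⇔ β → ⊢ ∘ α ⇔ ∘ β
⊢-R∘ (_ , d) = _ , R∘ (here refl) ∷ d

infix 3 _⊩_

-- Only modus ponens acts on hypotheses, so that the deduction theorem holds.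
data _⊩_ (Γ : List Formula) : Formula → Set where
  hyp : α ∈ Γ → Γ ⊩ α
  thm : ⊢ α → Γ ⊩ α
  mp  : Γ ⊩ α ⇒ β → Γ ⊩ α → Γ ⊩ β

⊩-closed : [] ⊩ α → ⊢ α
⊩-closed (thm d)  = d
⊩-closed (mp d e) = ⊢-mp (⊩-closed d) (⊩-closed e)

⊩-axiom : Axiom α → Γ ⊩ α
⊩-axiom a = thm (⊢-axiom a)

weaken : Γ ⊩ β → α ∷ Γ ⊩ β
weaken (hyp β∈Γ) = hyp (there β∈Γ)
weaken (thm d)   = thm d
weaken (mp d e)  = mp (weaken d) (weaken e)

⊩-identity : Γ ⊩ α ⇒ α
⊩-identity {α = α} =
  mp (mp (⊩-axiom (ax2 α (α ⇒ α) α)) (⊩-axiom (ax1 α (α ⇒ α)))) (⊩-axiom (ax1 α α))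

⊩-const : Γ ⊩ β → Γ ⊩ α ⇒ β
⊩-const = mp (⊩-axiom (ax1 _ _))

deduction : α ∷ Γ ⊩ β → Γ ⊩ α ⇒ β
deduction (hyp (here refl)) = ⊩-identity
deduction (hyp (there β∈Γ)) = ⊩-const (hyp β∈Γ)
deduction (thm d)           = ⊩-const (thm d)
deduction (mp d e)          = mp (mp (⊩-axiom (ax2 _ _ _)) (deduction d)) (deduction e)

⊩-trans : Γ ⊩ α ⇒ β → Γ ⊩ β ⇒ γ → Γ ⊩ α ⇒ γ
⊩-trans d e = mp (mp (⊩-axiom (ax2 _ _ _)) (⊩-const e)) d

∨-elim : Γ ⊩ α ∨ β → Γ ⊩ α ⇒ γ → Γ ⊩ β ⇒ γ → Γ ⊩ γ
∨-elim d e f = mp (mp (mp (⊩-axiom (ax8 _ _ _)) e) f) d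

-- Classical negation and signed formulas

⊥ : Formula
⊥ = var 0 ∧ (¬ var 0 ∧ ∘ var 0)

infix 9 ∼_

-- While `¬` tolerates contradictions, `∼` is a classical negation: `bc1` makes `⊥` explosive, and
-- `ax9` with consequent `⊥` is excluded middle for `∼`.
∼_ : Formula → Formula
∼ α = α ⇒ ⊥

bc1-elim : Γ ⊩ ∘ α → Γ ⊩ α → Γ ⊩ ¬ α → Γ ⊩ β
bc1-elim d e f = mp (mp (mp (⊩-axiom (bc1 _ _)) d) e) f

⊥-elim : Γ ⊩ ⊥ → Γ ⊩ α
⊥-elim d = bc1-elim (mp (⊩-axiom (ax5 _ _)) ¬p∧∘p) (mp (⊩-axiom (ax4 _ _)) d)
  (mp (⊩-axiom (ax4 _ _)) ¬p∧∘p)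
  where ¬p∧∘p = mp (⊩-axiom (ax5 _ _)) d

by-cases : ∀ α → α ∷ Γ ⊩ β → ∼ α ∷ Γ ⊩ β → Γ ⊩ β
by-cases α d e = ∨-elim (⊩-axiom (ax9 α ⊥)) (deduction e) (deduction d)

signed : Bool → Formula → Formula
signed true  α = α
signed false α = ∼ α

signed-∧ : ∀ a b → Γ ⊩ signed a α → Γ ⊩ signed b β → Γ ⊩ signed (a Bool.∧ b) (α ∧ β)
signed-∧ true  true  d e = mp (mp (⊩-axiom (ax3 _ _)) d) e
signed-∧ true  false d e = ⊩-trans (⊩-axiom (ax5 _ _)) e
signed-∧ false _     d e = ⊩-trans (⊩-axiom (ax4 _ _)) d

signed-∨ : ∀ a b → Γ ⊩ signed a α → Γ ⊩ signed b β → Γ ⊩ signed (a Bool.∨ b) (α ∨ β)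
signed-∨ true  _     d e = mp (⊩-axiom (ax6 _ _)) d
signed-∨ false true  d e = mp (⊩-axiom (ax7 _ _)) e
signed-∨ false false d e = mp (mp (⊩-axiom (ax8 _ _ _)) d) e

signed-⇒ : ∀ a b → Γ ⊩ signed a α → Γ ⊩ signed b β → Γ ⊩ signed (not a Bool.∨ b) (α ⇒ β)
signed-⇒ true  true  d e = ⊩-const e
signed-⇒ true  false d e =
  deduction (mp (weaken e) (mp (hyp (here refl)) (weaken d)))
signed-⇒ false _     d e = deduction (⊥-elim (mp (weaken d) (hyp (here refl))))

-- When `α` is refuted, `ax10` yields `¬ α` whatever `n` is; otherwise `n` decides.
signed-¬ : ∀ a n → Γ ⊩ signed a α → Γ ⊩ signed n (¬ α) → Γ ⊩ signed (not a Bool.∨ n) (¬ α)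
signed-¬ true  _ d e = e
signed-¬ false _ d e =
  ∨-elim (⊩-axiom (ax10 _)) (⊩-trans d (deduction (⊥-elim (hyp (here refl))))) ⊩-identity

-- `bc1` refutes `∘ α` once `α` and `¬ α` both hold; in all other cases `o` decides.
signed-∘ : ∀ a n o → Γ ⊩ signed a α → Γ ⊩ signed n (¬ α) → Γ ⊩ signed o (∘ α) →
           Γ ⊩ signed (not (a Bool.∧ n) Bool.∧ o) (∘ α)
signed-∘ true  true  _ d e f =
  ⊩-trans (⊩-axiom (bc1 _ ⊥)) (deduction (mp (mp (hyp (here refl)) (weaken d)) (weaken e)))
signed-∘ true  false _ d e f = f
signed-∘ false _     _ d e f = f

-- Valuations

Valuation : Set
Valuation = Formula → Bool

-- ¬ α and ∘ α have the same atoms, so that the instances of R¬ and of R∘ may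
-- both range over all arguments of ¬ and ∘ without leaving the atoms of φ.
atoms : Formula → List Formula
atoms (var p) = [ var p ]
atoms (α ∧ β) = atoms α ++ atoms β
atoms (α ∨ β) = atoms α ++ atoms β
atoms (α ⇒ β) = atoms α ++ atoms β
atoms (¬ α)   = ¬ α ∷ ∘ α ∷ atoms α
atoms (∘ α)   = ¬ α ∷ ∘ α ∷ atoms α

-- The values of `v` at `¬ α` and `∘ α` are arbitrary and stand in for `S¬` and `S∘`; the clauses
-- correct them so that `ax10` and `bc1` come out true.
eval : Valuation → Formula → Bool
eval v (var p) = v (var p)
eval v (α ∧ β) = eval v α Bool.∧ eval v β
eval v (α ∨ β) = eval v α Bool.∨ eval v β
eval v (α ⇒ β) = not (eval v α) Bool.∨ eval v β
eval v (¬ α)   = not (eval v α) Bool.∨ v (¬ α)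
eval v (∘ α)   = not (eval v α Bool.∧ (not (eval v α) Bool.∨ v (¬ α))) Bool.∧ v (∘ α)

Decides : List Formula → Valuation → List Formula → Set
Decides Γ v A = ∀ {α} → α ∈ A → Γ ⊩ signed (v α) α

-- Kalmár's lemma.
decides-eval : ∀ {v A} → Decides Γ v A → ∀ α → atoms α ⊆ A → Γ ⊩ signed (eval v α) α
decides-eval dec (var p) ⊆A = dec (⊆A (here refl))
decides-eval dec (α ∧ β) ⊆A = signed-∧ _ _
  (decides-eval dec α (⊆A ∘′ ∈-++⁺ˡ)) (decides-eval dec β (⊆A ∘′ ∈-++⁺ʳ _))
decides-eval dec (α ∨ β) ⊆A = signed-∨ _ _
  (decides-eval dec α (⊆A ∘′ ∈-++⁺ˡ)) (decides-eval dec β (⊆A ∘′ ∈-++⁺ʳ _))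
decides-eval dec (α ⇒ β) ⊆A = signed-⇒ _ _
  (decides-eval dec α (⊆A ∘′ ∈-++⁺ˡ)) (decides-eval dec β (⊆A ∘′ ∈-++⁺ʳ _))
decides-eval {v = v} dec (¬ α) ⊆A = signed-¬ (eval v α) _
  (decides-eval dec α (⊆A ∘′ there ∘′ there)) (dec (⊆A (here refl)))
decides-eval {v = v} dec (∘ α) ⊆A = signed-∘ (eval v α) _ _ dα
  (signed-¬ (eval v α) _ dα (dec (⊆A (here refl)))) (dec (⊆A (there (here refl))))
  where dα = decides-eval dec α (⊆A ∘′ there ∘′ there)

_[_↦_] : Valuation → Formula → Bool → Valuation
(v [ a ↦ b ]) x = if does (x ≟ a) then b else v x

bools : List Bool
bools = true ∷ false ∷ []

∈-bools : ∀ b → b ∈ bools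
∈-bools true  = here refl
∈-bools false = there (here refl)

valuations : List Formula → List Valuation
-- The default `false` is harmless: `Decides` inspects members of the list only.
valuations []      = [ (λ _ → false) ]
valuations (a ∷ A) = cartesianProductWith (λ b v → v [ a ↦ b ]) bools (valuations A)

-- Splitting on each atom in turn by `by-cases` leaves branches whose hypotheses decide all atoms as
-- some listed valuation does. `Δ` is the context grown along a branch.
valuations-exhaustive : ∀ A →
  (∀ {v Δ} → v ∈ valuations A → Γ ⊆ Δ → Decides Δ v A → Δ ⊩ ψ) → Γ ⊩ ψ
valuations-exhaustive []      h = h (here refl) id (λ ())
valuations-exhaustive {Γ} {ψ} (a ∷ A) h = by-cases a (branch true) (branch false)
  where
  decides-update : ∀ {v} b → signed b a ∈ Δ → Decides Δ v A → Decides Δ (v [ a ↦ b ]) (a ∷ A)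
  -- `a` may recur in `A`, so equality is tested before the position of `x`: the outermost update
  -- wins.
  decides-update b a∈Δ dec {x} x∈ with x ≟ a | x∈
  ... | yes refl | _         = hyp a∈Δ
  ... | no x≢a   | here x≡a  = contradiction x≡a x≢a
  ... | no _     | there x∈A = dec x∈A

  branch : ∀ b → signed b a ∷ Γ ⊩ ψ
  branch b = valuations-exhaustive A λ v∈ Γ⊆Δ dec →
    h (∈-cartesianProductWith⁺ (λ b v → v [ a ↦ b ]) (∈-bools b) v∈) (Γ⊆Δ ∘′ there)
      (decides-update b (Γ⊆Δ (here refl)) dec)

infix 3 _⊨ᵛ_ _⊨ᵛ?_

_⊨ᵛ_ : Valuation → Formula → Set
v ⊨ᵛ α = eval v α ≡ true

_⊨ᵛ?_ : ∀ v α → Dec (v ⊨ᵛ α)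
v ⊨ᵛ? α = eval v α Bool.≟ true

⊨ᵛ-⇔⁺ : ∀ v α β → eval v α ≡ eval v β → v ⊨ᵛ α ⇔ β
⊨ᵛ-⇔⁺ v α β eq with eval v α | eval v β
⊨ᵛ-⇔⁺ v α β refl | true  | true  = refl
⊨ᵛ-⇔⁺ v α β refl | false | false = refl

⊨ᵛ-⇔⁻ : ∀ v α β → v ⊨ᵛ α ⇔ β → eval v α ≡ eval v β
⊨ᵛ-⇔⁻ v α β eq with eval v α | eval v β
⊨ᵛ-⇔⁻ v α β eq | true  | true  = refl
⊨ᵛ-⇔⁻ v α β eq | false | false = refl

-- Elimination of valuations

-- Elimination form of "the disjunction of the descriptions over `A` of the members of `ws` is a
-- theorem"; this is the invariant of the deletion.
Complete : List Formula → List Valuation → Set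
Complete A ws = ∀ {ψ} → (∀ {v Δ} → v ∈ ws → Decides Δ v A → Δ ⊩ ψ) → ⊢ ψ

complete-⊢ : ∀ {A ws} → Complete A ws → atoms α ⊆ A → All (_⊨ᵛ α) ws → ⊢ α
complete-⊢ {α} complete ⊆A all = complete λ v∈ dec →
  subst (λ b → _ ⊩ signed b α) (All.lookup all v∈) (decides-eval dec α ⊆A)

-- A pair (π , κ) stands for the rule instance with premise π and conclusion κ.
RuleInstance : Set
RuleInstance = Formula × Formula

Admissible : List Formula → RuleInstance → Set
Admissible A (π , κ) = (⊢ π → ⊢ κ) × atoms π ⊆ A × atoms κ ⊆ A

-- `R¬` and `R∘` act on theorems only, so the premise is tested at all of `ws`, the conclusion at
-- `v` alone.
Obeys : List Valuation → Valuation → RuleInstance → Set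
Obeys ws v (π , κ) = All (_⊨ᵛ π) ws → v ⊨ᵛ κ

obeys? : ∀ ws v → Decidable (Obeys ws v)
obeys? ws v (π , κ) = All.all? (_⊨ᵛ? π) ws →-dec v ⊨ᵛ? κ

Closed : List RuleInstance → List Valuation → Set
Closed R ws = All (λ v → All (Obeys ws v) R) ws

module _ {A : List Formula} {R : List RuleInstance} (adm : All (Admissible A) R) where

  -- A violated instance has a premise true throughout `ws`, hence a theorem by `complete-⊢`; so its
  -- conclusion is a theorem too, yet the description of `v` refutes it.
  refute : ∀ {ws v} r → Admissible A r → Complete A ws → Nullary.¬ Obeys ws v r →
           Decides Δ v A → Δ ⊩ ψ
  refute {ws = ws} {v = v} (π , κ) (rule , π⊆A , κ⊆A) complete ¬obeys dec
    with All.all? (_⊨ᵛ? π) ws | v ⊨ᵛ? κ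
  ... | no ¬all | _      = contradiction (λ all → contradiction all ¬all) ¬obeys
  ... | yes _   | yes ⊨κ = contradiction (λ _ → ⊨κ) ¬obeys
  ... | yes all | no ⊭κ  = ⊥-elim (mp
    (subst (λ b → _ ⊩ signed b κ) (¬-not ⊭κ) (decides-eval dec κ κ⊆A))
    (thm (rule (complete-⊢ complete π⊆A all))))

  complete-filter : ∀ {ws} → Complete A ws →
    Complete A (filter (λ v → All.all? (obeys? ws v) R) ws)
  complete-filter {ws} complete h = complete λ {v} v∈ dec →
    case All.all? (obeys? ws v) R of λ where
      (yes obeys) → h (∈-filter⁺ _ v∈ obeys) dec
      (no ¬obeys) → let r , r∈ , ¬r = find (¬All⇒Any¬ (obeys? ws v) R ¬obeys)
                    in refute r (All.lookup adm r∈) complete ¬r dec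

  -- A deletion can make further premises true throughout the list, so the filter is repeated; each
  -- round that finds a violation shortens the list.
  closure : ∀ ws → Acc _<_ (length ws) → Complete A ws →
            ∃[ ws′ ] Complete A ws′ × Closed R ws′
  closure ws (acc rec) complete with All.all? (λ v → All.all? (obeys? ws v) R) ws
  ... | yes closed = ws , complete , closed
  ... | no ¬closed = closure _
    (rec (filter-notAll _ ws (¬All⇒Any¬ (λ v → All.all? (obeys? ws v) R) ws ¬closed)))
    (complete-filter complete)

-- The neighborhood model of the surviving valuations

arguments : Formula → List Formula
arguments (var p) = []
arguments (α ∧ β) = arguments α ++ arguments β
arguments (α ∨ β) = arguments α ++ arguments β
arguments (α ⇒ β) = arguments α ++ arguments β
arguments (¬ α)   = α ∷ arguments α
arguments (∘ α)   = α ∷ arguments α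

atoms-argument : ∀ φ → α ∈ arguments φ → atoms (¬ α) ⊆ atoms φ
atoms-argument-++ : ∀ φ ψ → α ∈ arguments φ ++ arguments ψ → atoms (¬ α) ⊆ atoms φ ++ atoms ψ

atoms-argument (φ ∧ ψ) = atoms-argument-++ φ ψ
atoms-argument (φ ∨ ψ) = atoms-argument-++ φ ψ
atoms-argument (φ ⇒ ψ) = atoms-argument-++ φ ψ
atoms-argument (¬ φ) (here refl) = id
atoms-argument (¬ φ) (there α∈)  = there ∘′ there ∘′ atoms-argument φ α∈
atoms-argument (∘ φ) (here refl) = id
atoms-argument (∘ φ) (there α∈)  = there ∘′ there ∘′ atoms-argument φ α∈

atoms-argument-++ φ ψ α∈ = [ (λ α∈φ → ∈-++⁺ˡ ∘′ atoms-argument φ α∈φ)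
                           , (λ α∈ψ → ∈-++⁺ʳ (atoms φ) ∘′ atoms-argument ψ α∈ψ) ]′
                           (∈-++⁻ (arguments φ) α∈)

congruence : (Formula → Formula) → Formula → Formula → RuleInstance
congruence op α β = (α ⇔ β) , (op α ⇔ op β)

instances : List Formula → List RuleInstance
instances N =
  cartesianProductWith (congruence ¬_) N N ++ cartesianProductWith (congruence ∘_) N N

atoms-⇔ : ∀ {A} → atoms α ⊆ A → atoms β ⊆ A → atoms (α ⇔ β) ⊆ A
atoms-⇔ {α} {β} α⊆A β⊆A = ++-⊆ (++-⊆ α⊆A β⊆A) (++-⊆ β⊆A α⊆A)
  where
  ++-⊆ : ∀ {xs ys zs : List Formula} → xs ⊆ zs → ys ⊆ zs → xs ++ ys ⊆ zs
  ++-⊆ {xs} xs⊆ ys⊆ = [ xs⊆ , ys⊆ ]′ ∘′ ∈-++⁻ xs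

instances-admissible : ∀ φ → All (Admissible (atoms φ)) (instances (arguments φ))
instances-admissible φ = ++⁺
  (cartesianProductWith⁺ (setoid _) (setoid _) _ N N λ {α} {β} α∈ β∈ →
    ⊢-R¬ , atoms-⇔ {α} {β} (inner α∈) (inner β∈)
         , atoms-⇔ {¬ α} {¬ β} (atoms-argument φ α∈) (atoms-argument φ β∈))
  (cartesianProductWith⁺ (setoid _) (setoid _) _ N N λ {α} {β} α∈ β∈ →
    ⊢-R∘ , atoms-⇔ {α} {β} (inner α∈) (inner β∈)
         , atoms-⇔ {∘ α} {∘ β} (atoms-argument φ α∈) (atoms-argument φ β∈))
  where
  N = arguments φ
  inner : ∀ {α} → α ∈ N → atoms α ⊆ atoms φ
  inner α∈ = atoms-argument φ α∈ ∘′ there ∘′ there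

-- In the model below, `S¬ ⟦ φ ⟧` is the whole truth set of `¬ φ`, which already contains the
-- complement of `⟦ φ ⟧`; the clause for `¬` adds that complement a second time.
∨-absorb : ∀ x y → x Bool.∨ (x Bool.∨ y) ≡ x Bool.∨ y
∨-absorb x y = trans (sym (∨-assoc x x y)) (cong (Bool._∨ y) (∨-idem x))

∧-absorb : ∀ x y → x Bool.∧ (x Bool.∧ y) ≡ x Bool.∧ y
∧-absorb x y = trans (sym (∧-assoc x x y)) (cong (Bool._∧ y) (∧-idem x))

module _ (N : List Formula) {ws : List Valuation} (closed : Closed (instances N) ws)
         (i₀ : Fin (length ws)) where

  World : Set
  World = Fin (length ws)

  truth : Formula → ℘ World
  truth α i = eval (lookup ws i) α

  agree? : (X : ℘ World) → ∀ α → Dec (X ≗ truth α)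
  agree? X α = all? λ i → X i Bool.≟ truth α i

  -- Equal truth sets make `α ⇔ β` true at every survivor, which is the premise that `closed` asks
  -- for.
  congruent : ∀ {op α β} → congruence op α β ∈ instances N →
              truth α ≗ truth β → truth (op α) ≗ truth (op β)
  congruent {op} {α} {β} r∈ eq i = ⊨ᵛ-⇔⁻ (lookup ws i) (op α) (op β)
    (All.lookup (All.lookup closed (∈-lookup i)) r∈
      (All.tabulate λ v∈ → subst (_⊨ᵛ α ⇔ β) (sym (lookup-index v∈))
        (⊨ᵛ-⇔⁺ (lookup ws (Any.index v∈)) α β (eq (Any.index v∈)))))

  module _ (op : Formula → Formula) where

    neighbour? : ∀ X i → Dec (Any (λ α → X ≗ truth α × lookup ws i ⊨ᵛ op α) N)
    neighbour? X i = Any.any? (λ α → agree? X α ×-dec (lookup ws i ⊨ᵛ? op α)) N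

    -- A set that is the truth set of no member of `N` is sent to the empty set. Finiteness of
    -- `World` and `N` makes the search decidable.
    S : ℘ World → ℘ World
    S X i = does (neighbour? X i)

    S-cong : ∀ {X Y} → X ≗ Y → S X ≗ S Y
    S-cong {X} {Y} X≗Y i = does-⇔
      (mk⇔ (Any.map (Product.map₁ (λ X≗ j → trans (sym (X≗Y j)) (X≗ j))))
           (Any.map (Product.map₁ (λ Y≗ j → trans (X≗Y j) (Y≗ j)))))
      (neighbour? X i) (neighbour? Y i)

    -- The choice of representative is immaterial: any other `β` in `N` with truth set `X` agrees
    -- with `α` after applying `op`, by `congruent`.
    S-truth : (∀ {α β} → α ∈ N → β ∈ N → congruence op α β ∈ instances N) →
              ∀ {X α} → α ∈ N → X ≗ truth α → S X ≗ truth (op α)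
    S-truth ∈-instances {X} {α} α∈ X≗α i with truth (op α) i in eq
    ... | true  = dec-true (neighbour? X i) (lose α∈ (X≗α , eq))
    ... | false = dec-false (neighbour? X i) λ any →
      let β , β∈ , X≗β , ⊨opβ = find any
          opα≡opβ = congruent {op} (∈-instances α∈ β∈) (λ j → trans (sym (X≗α j)) (X≗β j)) i
      in case trans (sym eq) (trans opα≡opβ ⊨opβ) of λ ()

  model : Model
  model = record
    { frame = record
      { W = World ; point = i₀
      ; S¬ = S ¬_ ; S∘ = S ∘_ ; S¬-cong = S-cong ¬_ ; S∘-cong = S-cong ∘_ }
    ; d = λ p i → lookup ws i (var p)
    }

  open Model model using (⟦_⟧)

  S¬-truth : α ∈ N → ⟦ α ⟧ ≗ truth α → S ¬_ ⟦ α ⟧ ≗ truth (¬ α)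
  S¬-truth = S-truth ¬_ λ α∈ β∈ → ∈-++⁺ˡ (∈-cartesianProductWith⁺ (congruence ¬_) α∈ β∈)

  S∘-truth : α ∈ N → ⟦ α ⟧ ≗ truth α → S ∘_ ⟦ α ⟧ ≗ truth (∘ α)
  S∘-truth = S-truth ∘_ λ α∈ β∈ → ∈-++⁺ʳ _ (∈-cartesianProductWith⁺ (congruence ∘_) α∈ β∈)

  truth-lemma : ∀ φ → arguments φ ⊆ N → ⟦ φ ⟧ ≗ truth φ
  truth-lemma (var p) ⊆N i = refl
  truth-lemma (φ ∧ ψ) ⊆N i = cong₂ Bool._∧_
    (truth-lemma φ (⊆N ∘′ ∈-++⁺ˡ) i) (truth-lemma ψ (⊆N ∘′ ∈-++⁺ʳ _) i)
  truth-lemma (φ ∨ ψ) ⊆N i = cong₂ Bool._∨_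
    (truth-lemma φ (⊆N ∘′ ∈-++⁺ˡ) i) (truth-lemma ψ (⊆N ∘′ ∈-++⁺ʳ _) i)
  truth-lemma (φ ⇒ ψ) ⊆N i = cong₂ (λ a b → not a Bool.∨ b)
    (truth-lemma φ (⊆N ∘′ ∈-++⁺ˡ) i) (truth-lemma ψ (⊆N ∘′ ∈-++⁺ʳ _) i)
  truth-lemma (¬ φ) ⊆N i = trans
    (cong₂ (λ a n → not a Bool.∨ n) (ih i) (S¬-truth (⊆N (here refl)) ih i))
    (∨-absorb (not (truth φ i)) _)
    where ih = truth-lemma φ (⊆N ∘′ there)
  truth-lemma (∘ φ) ⊆N i = trans
    (cong₂ (λ a o → not a Bool.∧ o)
      (cong₂ Bool._∧_ (ih i) (S¬-truth (⊆N (here refl)) ih i))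
      (S∘-truth (⊆N (here refl)) ih i))
    (∧-absorb (not (truth φ i Bool.∧ truth (¬ φ) i)) _)
    where ih = truth-lemma φ (⊆N ∘′ there)

-- Completeness

weak-completeness : ∀ φ → ⊨ φ → ⊢ φ
weak-completeness φ ⊨φ = complete-⊢ complete id (All.tabulate λ v∈ →
  subst (_⊨ᵛ φ) (sym (lookup-index v∈))
    (trans (sym (truth-lemma N closed (Any.index v∈) φ id (Any.index v∈)))
           -- The survivor under consideration serves as the point of the model.
           (⊨φ (model N closed (Any.index v∈)) (Any.index v∈))))
  where
  N = arguments φ

  survivors : ∃[ ws ] Complete (atoms φ) ws × Closed (instances N) ws
  survivors = closure (instances-admissible φ) (valuations (atoms φ)) (<-wellFounded _)
    λ h → ⊩-closed (valuations-exhaustive (atoms φ) λ v∈ _ → h v∈)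

  complete = proj₁ (proj₂ survivors)
  closed   = proj₂ (proj₂ survivors)

theorem5p7 : ∀ {ℓ : Level} (Γ : Pred Formula ℓ) (φ : Formula) → Γ ⊨ φ → Γ ⊢ φ
theorem5p7 Γ φ = Sum.map (weak-completeness φ)
  (Product.map₂ (Product.map₂ (weak-completeness _)))
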